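{- For a permutation $\rho$ of $\{1,2,3\}$, let $a_{n,k}^{\mathrm{pk}}(\rho)$ denote the number of permutations of $\{1,\dots,n\}$ that avoid $\rho$ and have exactly $k$ peaks. Then for all $n$ and $k$, $$a_{n,k}^{\mathrm{pk}}(312)=a_{n,k}^{\mathrm{pk}}(321).$$
   Context: Here $n,k$ are nonnegative integers. $\mathcal{S}_n$ is the set of permutations $\pi=\pi_1\cdots\pi_n$ of $\{1,\dots,n\}$. For $\rho\in\mathcal{S}_m$, $\pi\in\mathcal{S}_n$ contains $\rho$ if there are indices $1\le i_1<\cdots<i_m\le n$ such that $\pi_{i_a}<\pi_{i_b}$ if and only if $\rho_a<\rho_b$; otherwise $\pi$ avoids $\rho$. The number of peaks is $\mathrm{pk}(\pi)=|\{i : \pi_i<\pi_{i+1}\text{ and }\pi_{i+1}>\pi_{i+2}\}|$, where $1\le i\le n-2$. -}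

module Defs where

open import Data.Fin.Base using (Fin; suc; inject₁; _<_; _>_; punchIn)
open import Data.Fin.Patterns using (0F; 1F; 2F)
open import Data.Fin.Permutation using (Permutation′; permutation; _⟨$⟩ʳ_; _≈_; id; insert; remove; insert-punchIn; insert-remove)
open import Data.Fin.Properties using (_<?_; all?; any?; punchIn-injective)
open import Data.List.Base using (List; []; _∷_; length; filter; allFin; cartesianProductWith)
open import Data.List.Membership.Propositional.Properties using (∈-allFin)
import Data.List.Membership.Setoid.Properties as Membershipₚ
open import Data.List.Relation.Unary.All using ([])
open import Data.List.Relation.Unary.AllPairs using ([]; _∷_)
open import Data.List.Relation.Unary.Any using (here)
import Data.List.Relation.Unary.Enumerates.Setoid as Enumerates
import Data.List.Relation.Unary.Unique.Setoid as Unique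
import Data.List.Relation.Unary.Unique.Propositional.Properties as Uniqueₚ
import Data.List.Relation.Unary.Unique.Setoid.Properties as UniqueSetoidₚ
open import Data.Nat.Base using (ℕ; zero; suc; 2+)
import Data.Nat.Properties as ℕ
open import Data.Product.Base using (∃-syntax; _×_; _,_; proj₁; proj₂)
open import Data.Vec.Base using (Vec; []; _∷_; lookup)
open import Function.Base using (_∘_)
open import Function.Bundles using (_⇔_; mk⇔; Equivalence)
open import Level using (0ℓ)
open import Relation.Binary.Bundles using (Setoid)
open import Relation.Binary.PropositionalEquality using (_≡_; refl; sym; trans; cong; setoid; module ≡-Reasoning)
open import Relation.Nullary using (Dec; ¬_; ¬?; _×-dec_; _→-dec_)
open import Relation.Nullary.Decidable using (map′)
open import Relation.Unary using (Decidable)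

private
  variable
    m n : ℕ

-- Positions and values are 0-based: a permutation π₁⋯πₙ of {1,…,n} is the
-- bijection of Fin n with π ⟨$⟩ʳ i = πᵢ₊₁ - 1.  Only relative order matters.

IsOccurrence : Permutation′ m → Permutation′ n → Vec (Fin n) m → Set
IsOccurrence ρ π ι =
  (∀ a b → a < b → lookup ι a < lookup ι b) ×
  (∀ a b → (π ⟨$⟩ʳ lookup ι a < π ⟨$⟩ʳ lookup ι b) ⇔ (ρ ⟨$⟩ʳ a < ρ ⟨$⟩ʳ b))

Contains : Permutation′ n → Permutation′ m → Set
Contains {n} {m} π ρ = ∃[ ι ] IsOccurrence {m} {n} ρ π ι

Avoids : Permutation′ n → Permutation′ m → Set
Avoids π ρ = ¬ Contains π ρ

private
  _⇔-dec_ : {A B : Set} → Dec A → Dec B → Dec (A ⇔ B)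
  a? ⇔-dec b? = map′ (λ (f , g) → mk⇔ f g) (λ e → Equivalence.to e , Equivalence.from e)
                     ((a? →-dec b?) ×-dec (b? →-dec a?))

  anyVec? : ∀ m {P : Vec (Fin n) m → Set} → Decidable P → Dec (∃[ v ] P v)
  anyVec? zero    P? = map′ (λ p → [] , p) (λ { ([] , p) → p }) (P? [])
  anyVec? (suc m) P? =
    map′ (λ (x , v , p) → x ∷ v , p) (λ { (x ∷ v , p) → x , v , p })
         (any? λ x → anyVec? m λ v → P? (x ∷ v))

isOccurrence? : (ρ : Permutation′ m) (π : Permutation′ n) → Decidable (IsOccurrence ρ π)
isOccurrence? ρ π ι =
  (all? λ a → all? λ b → (a <? b) →-dec (lookup ι a <? lookup ι b)) ×-dec
  (all? λ a → all? λ b →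
    (π ⟨$⟩ʳ lookup ι a <? π ⟨$⟩ʳ lookup ι b) ⇔-dec (ρ ⟨$⟩ʳ a <? ρ ⟨$⟩ʳ b))

avoids? : (π : Permutation′ n) (ρ : Permutation′ m) → Dec (Avoids π ρ)
avoids? {m = m} π ρ = ¬? (anyVec? m (isOccurrence? ρ π))

-- The argument i is the left end of the window of positions i, i+1, i+2.
PeakAt : Permutation′ (2+ n) → Fin n → Set
PeakAt π i =
  (π ⟨$⟩ʳ inject₁ (inject₁ i) < π ⟨$⟩ʳ suc (inject₁ i)) ×
  (π ⟨$⟩ʳ suc (inject₁ i) > π ⟨$⟩ʳ suc (suc i))

peakAt? : (π : Permutation′ (2+ n)) → Decidable (PeakAt π)
peakAt? π i = (_ <? _) ×-dec (_ <? _)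

pk : Permutation′ n → ℕ
pk {0}    π = 0
pk {1}    π = 0
pk {2+ n} π = length (filter (peakAt? π) (allFin n))

-- `insert 0F j π` has first value j, followed by the values of π with those
-- ≥ j shifted up by one.
permutations : ∀ n → List (Permutation′ n)
permutations zero    = id ∷ []
permutations (suc n) = cartesianProductWith (insert 0F) (allFin (suc n)) (permutations n)

permutationSetoid : ℕ → Setoid 0ℓ 0ℓ
permutationSetoid n = record
  { Carrier       = Permutation′ n
  ; _≈_           = _≈_
  ; isEquivalence = record
    { refl  = λ _ → refl
    ; sym   = λ p i → sym (p i)
    ; trans = λ p q i → trans (p i) (q i)
    }
  }

private
  insert-cong : ∀ {j k : Fin (suc n)} {π σ : Permutation′ n} →
                j ≡ k → π ≈ σ → insert 0F j π ≈ insert 0F k σ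
  insert-cong         refl p 0F      = refl
  insert-cong {j = j} refl p (suc i) = cong (punchIn j) (p i)

  insert-injective : ∀ {j k : Fin (suc n)} {π σ : Permutation′ n} →
                     insert 0F j π ≈ insert 0F k σ → j ≡ k × π ≈ σ
  insert-injective {j = j} {π = π} {σ} p with p 0F
  ... | refl = refl , λ i → punchIn-injective j _ _ (begin
    punchIn j (π ⟨$⟩ʳ i)          ≡⟨ insert-punchIn 0F j π i ⟨
    insert 0F j π ⟨$⟩ʳ suc i      ≡⟨ p (suc i) ⟩
    insert 0F j σ ⟨$⟩ʳ suc i      ≡⟨ insert-punchIn 0F j σ i ⟩
    punchIn j (σ ⟨$⟩ʳ i)          ∎)
    where open ≡-Reasoning

permutations-complete : ∀ n → Enumerates.IsEnumeration (permutationSetoid n) (permutations n)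
permutations-complete zero    π = here λ ()
permutations-complete (suc n) π =
  ∈-resp-≈ (permutationSetoid (suc n)) {permutations (suc n)}
    {insert 0F (π ⟨$⟩ʳ 0F) (remove 0F π)} {π} (insert-remove 0F π)
    (∈-cartesianProductWith⁺ (setoid _) (permutationSetoid n) (permutationSetoid (suc n))
      {f = insert 0F} (λ {_} {_} {π} {σ} → insert-cong {π = π} {σ})
      {xs = allFin (suc n)} {ys = permutations n}
      (∈-allFin (π ⟨$⟩ʳ 0F)) (permutations-complete n (remove 0F π)))
  where open Membershipₚ using (∈-resp-≈; ∈-cartesianProductWith⁺)

permutations-unique : ∀ n → Unique.Unique (permutationSetoid n) (permutations n)
permutations-unique zero    = [] ∷ []
permutations-unique (suc n) =
  UniqueSetoidₚ.cartesianProductWith⁺ (setoid _) (permutationSetoid n) (permutationSetoid (suc n))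
    (insert 0F) (λ {_} {_} {π} {σ} → insert-injective {π = π} {σ})
    (Uniqueₚ.allFin⁺ (suc n)) (permutations-unique n)

-- `permutations n` lists each permutation exactly once up to `_≈_`
-- (permutations-complete, permutations-unique), so this length is a cardinality.
aᵖᵏ : ℕ → ℕ → Permutation′ 3 → ℕ
aᵖᵏ n k ρ =
  length (filter (λ π → avoids? π ρ ×-dec (pk π ℕ.≟ k)) (permutations n))

p312 : Permutation′ 3
p312 = permutation (lookup (2F ∷ 0F ∷ 1F ∷ [])) (lookup (1F ∷ 2F ∷ 0F ∷ []))
  (λ { 0F → refl ; 1F → refl ; 2F → refl })
  (λ { 0F → refl ; 1F → refl ; 2F → refl })

p321 : Permutation′ 3
p321 = permutation (lookup (2F ∷ 1F ∷ 0F ∷ [])) (lookup (2F ∷ 1F ∷ 0F ∷ []))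
  (λ { 0F → refl ; 1F → refl ; 2F → refl })
  (λ { 0F → refl ; 1F → refl ; 2F → refl })

{-# OPTIONS --safe #-}

-- Read a permutation from left to right, remembering only the number a of
-- unused values below the current maximum.  In a 312- or 321-avoiding
-- permutation the next letter is either a new left-to-right maximum, or one
-- particular unused value below the maximum: the largest one for 312, the
-- smallest one for 321.  In both cases the peaks are exactly the left-to-right
-- maxima, other than the first letter, that are followed by a letter which is
-- not one.  So the two counts, refined by a, satisfy the same recursion.
module Submission where

open import Data.Bool.Base using (true; false; if_then_else_)
open import Data.Fin.Base using (Fin; zero; suc; toℕ; inject₁; _<_; _>_; _≤_; punchIn)
open import Data.Fin.Patterns using (0F; 1F; 2F)
open import Data.Fin.Permutation using (Permutation′; _⟨$⟩ʳ_; _⟨$⟩ˡ_; inverseˡ; inverseʳ; insert)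
open import Data.Fin.Properties using (punchIn-mono-≤; punchIn-cancel-≤; punchInᵢ≢i; <-cmp; ≤∧≢⇒<; toℕ-inject₁; toℕ<n)
open import Data.List.Base using (List; []; _∷_; _++_; length; map; filter; tabulate; cartesianProductWith)
open import Data.List.Properties using (filter-≐; filter-none; filter-++; length-++)
import Data.List.Relation.Unary.All as All
open import Data.Nat.Base as ℕ using (ℕ; zero; suc; 2+; _+_; z≤n; s≤s; z<s; s<s)
import Data.Nat.Properties as ℕ
open import Data.Product.Base using (_×_; _,_; proj₂)
open import Data.Vec.Base using ([]; _∷_; lookup)
open import Data.Vec.Functional using (removeAt)
open import Function.Base using (_∘_; id)
open import Function.Bundles using (_⇔_; mk⇔; Equivalence)
open import Relation.Binary.Definitions using (tri<; tri≈; tri>)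
open import Relation.Binary.PropositionalEquality using (_≡_; _≢_; refl; sym; trans; cong; cong₂; subst; subst₂; module ≡-Reasoning)
open import Relation.Nullary using (Dec; yes; no; does; ¬_; _×-dec_; contradiction)
open import Relation.Nullary.Decidable using (does-⇔)
open import Relation.Unary using (Decidable)
open import Algebra.Properties.CommutativeMonoid.Sum ℕ.+-0-commutativeMonoid using (sum; sum-remove; sum-cong-≗)
open import Defs

private
  variable
    m n : ℕ

-- Order properties of `punchIn`.

punchIn-mono-< : ∀ (i : Fin (suc n)) {j k : Fin n} → j < k → punchIn i j < punchIn i k
punchIn-mono-< i {j} {k} j<k = ℕ.≰⇒> (ℕ.<⇒≱ j<k ∘ punchIn-cancel-≤ i k j)

punchIn-cancel-< : ∀ (i : Fin (suc n)) {j k : Fin n} → punchIn i j < punchIn i k → j < k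
punchIn-cancel-< i {j} {k} lt = ℕ.≰⇒> (ℕ.<⇒≱ lt ∘ punchIn-mono-≤ i k j)

punchIn-≤ : ∀ (i : Fin (suc n)) (j : Fin n) → toℕ i ℕ.≤ toℕ j → punchIn i j ≡ suc j
punchIn-≤ zero    j       _         = refl
punchIn-≤ (suc i) (suc j) (s≤s i≤j) = cong suc (punchIn-≤ i j i≤j)

punchIn-> : ∀ (i : Fin (suc n)) (j : Fin n) → toℕ j ℕ.< toℕ i → punchIn i j ≡ inject₁ j
punchIn-> (suc i) zero    _         = refl
punchIn-> (suc i) (suc j) (s<s j<i) = cong suc (punchIn-> i j j<i)

-- This decides descents: the second letter of `a ◂ j ◂ σ`, which is `punchIn a j`, lies below the
-- first exactly when `j` lies below `a`.
punchIn<⇔ : ∀ (i : Fin (suc n)) (j : Fin n) → punchIn i j < i ⇔ toℕ j ℕ.< toℕ i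
punchIn<⇔ i j = mk⇔ (to i j) (from i j)
  where
  to : ∀ (i : Fin (suc n)) (j : Fin n) → punchIn i j < i → toℕ j ℕ.< toℕ i
  to (suc i) zero    _        = z<s
  to (suc i) (suc j) (s<s lt) = s<s (to i j lt)

  from : ∀ (i : Fin (suc n)) (j : Fin n) → toℕ j ℕ.< toℕ i → punchIn i j < i
  from (suc i) zero    _        = z<s
  from (suc i) (suc j) (s<s lt) = s<s (from i j lt)

-- The cosimplicial identity for coface maps. It lets the second of two leading letters be stripped
-- off before the first.
punchIn-comm : ∀ {i j : Fin (suc n)} → j ≤ i → ∀ k →
               punchIn (suc i) (punchIn j k) ≡ punchIn (inject₁ j) (punchIn i k)
punchIn-comm {i = i}     {zero}  _         k       = refl
punchIn-comm {i = suc i} {suc j} (s≤s j≤i) zero    = refl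
punchIn-comm {i = suc i} {suc j} (s≤s j≤i) (suc k) = cong suc (punchIn-comm j≤i k)

-- Occurrences of 312 and 321 in a common form.

data Shape : Set where
  up down : Shape

pattern-of : Shape → Permutation′ 3
pattern-of up   = p312
pattern-of down = p321

Ordered : Shape → Fin n → Fin n → Set
Ordered up   i j = i < j
Ordered down i j = i > j

ordered-map : ∀ s {f : Fin m} {g} {f′ : Fin n} {g′} →
              (f < g → f′ < g′) → (g < f → g′ < f′) → Ordered s f g → Ordered s f′ g′
ordered-map up   p q = p
ordered-map down p q = q

-- Both patterns begin with their largest letter and differ only in the order of the other two, so
-- `ordered` is the only field that depends on the shape.
record Occurrence (s : Shape) (f : Fin n → Fin m) : Set where
  constructor occ
  field
    {i j k} : Fin n
    i<j     : i < j
    j<k     : j < k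
    fj<fi   : f j < f i
    fk<fi   : f k < f i
    ordered : Ordered s (f j) (f k)

-- The values of `ρ` are distinct and linearly ordered, so by trichotomy monotonicity already forces
-- reflection.
<-reflecting : ∀ (ρ : Permutation′ m) {g : Fin m → Fin n} →
               (∀ a b → ρ ⟨$⟩ʳ a < ρ ⟨$⟩ʳ b → g a < g b) →
               ∀ a b → g a < g b ⇔ ρ ⟨$⟩ʳ a < ρ ⟨$⟩ʳ b
<-reflecting ρ {g} mono a b = mk⇔ reflect (mono a b)
  where
  reflect : g a < g b → ρ ⟨$⟩ʳ a < ρ ⟨$⟩ʳ b
  reflect ga<gb with <-cmp (ρ ⟨$⟩ʳ a) (ρ ⟨$⟩ʳ b)
  ... | tri< lt _ _ = lt
  ... | tri> _ _ gt = contradiction (mono b a gt) (ℕ.<-asym ga<gb)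
  ... | tri≈ _ eq _ = contradiction ga<gb (ℕ.<-irrefl (cong (toℕ ∘ g) a≡b))
    where
    a≡b : a ≡ b
    a≡b = trans (sym (inverseˡ ρ)) (trans (cong (ρ ⟨$⟩ˡ_) eq) (inverseˡ ρ))

contains⇔occurrence : ∀ s (π : Permutation′ n) →
                      Contains π (pattern-of s) ⇔ Occurrence s (π ⟨$⟩ʳ_)
contains⇔occurrence s π = mk⇔ (to s) (from s)
  where
  to : ∀ s → Contains π (pattern-of s) → Occurrence s (π ⟨$⟩ʳ_)
  to up   (_ , inc , iff) =
    occ (inc 0F 1F z<s) (inc 1F 2F (s<s z<s))
        (Equivalence.from (iff 1F 0F) z<s) (Equivalence.from (iff 2F 0F) (s<s z<s))
        (Equivalence.from (iff 1F 2F) z<s)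
  to down (_ , inc , iff) =
    occ (inc 0F 1F z<s) (inc 1F 2F (s<s z<s))
        (Equivalence.from (iff 1F 0F) (s<s z<s)) (Equivalence.from (iff 2F 0F) z<s)
        (Equivalence.from (iff 2F 1F) z<s)

  increasing : ∀ {i j k : Fin n} → i < j → j < k → ∀ a b → a < b →
               lookup (i ∷ j ∷ k ∷ []) a < lookup (i ∷ j ∷ k ∷ []) b
  increasing i<j j<k 0F 1F _ = i<j
  increasing i<j j<k 0F 2F _ = ℕ.<-trans i<j j<k
  increasing i<j j<k 1F 2F _ = j<k
  increasing i<j j<k 1F 1F (s<s ())
  increasing i<j j<k 2F 1F (s<s ())
  increasing i<j j<k 2F 2F (s<s (s<s ()))

  from : ∀ s → Occurrence s (π ⟨$⟩ʳ_) → Contains π (pattern-of s)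
  from up (occ {i} {j} {k} i<j j<k fj<fi fk<fi fj<fk) =
    i ∷ j ∷ k ∷ [] , increasing i<j j<k , <-reflecting p312 mono
    where
    mono : ∀ a b → p312 ⟨$⟩ʳ a < p312 ⟨$⟩ʳ b →
           π ⟨$⟩ʳ lookup (i ∷ j ∷ k ∷ []) a < π ⟨$⟩ʳ lookup (i ∷ j ∷ k ∷ []) b
    mono 1F 0F _ = fj<fi
    mono 2F 0F _ = fk<fi
    mono 1F 2F _ = fj<fk
    mono 0F 0F (s<s (s<s ()))
    mono 0F 2F (s<s ())
    mono 2F 2F (s<s ())
  from down (occ {i} {j} {k} i<j j<k fj<fi fk<fi fk<fj) =
    i ∷ j ∷ k ∷ [] , increasing i<j j<k , <-reflecting p321 mono
    where
    mono : ∀ a b → p321 ⟨$⟩ʳ a < p321 ⟨$⟩ʳ b →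
           π ⟨$⟩ʳ lookup (i ∷ j ∷ k ∷ []) a < π ⟨$⟩ʳ lookup (i ∷ j ∷ k ∷ []) b
    mono 1F 0F _ = fj<fi
    mono 2F 0F _ = fk<fi
    mono 2F 1F _ = fk<fj
    mono 0F 0F (s<s (s<s ()))
    mono 0F 1F (s<s ())
    mono 0F 2F ()
    mono 1F 1F (s<s ())
    mono 1F 2F ()
    mono 2F 2F ()

avoids-short : ∀ s (π : Permutation′ n) → n ℕ.< 3 → Avoids π (pattern-of s)
avoids-short s π n<3 con with Equivalence.to (contains⇔occurrence s π) con
... | occ {k = k} i<j j<k _ _ _ =
  ℕ.<⇒≱ n<3 (ℕ.≤-trans (s≤s (ℕ.≤-trans (s≤s (ℕ.≤-trans (s≤s z≤n) i<j)) j<k)) (toℕ<n k))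

avoids-map : ∀ s {π : Permutation′ m} {σ : Permutation′ n} →
             (Occurrence s (σ ⟨$⟩ʳ_) → Occurrence s (π ⟨$⟩ʳ_)) →
             Avoids π (pattern-of s) → Avoids σ (pattern-of s)
avoids-map s {π} {σ} f av =
  av ∘ Equivalence.from (contains⇔occurrence s π) ∘ f ∘ Equivalence.to (contains⇔occurrence s σ)

-- Effect of the leading letters on occurrences.

infixr 5 _◂_

_◂_ : Fin (suc n) → Permutation′ n → Permutation′ (suc n)
j ◂ π = insert 0F j π

occurrence-tail : ∀ s (a : Fin (suc n)) (π : Permutation′ n) →
                  Occurrence s (π ⟨$⟩ʳ_) → Occurrence s ((a ◂ π) ⟨$⟩ʳ_)
occurrence-tail s a π (occ i<j j<k fj<fi fk<fi r) =
  occ (s<s i<j) (s<s j<k) (punchIn-mono-< a fj<fi) (punchIn-mono-< a fk<fi)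
      (ordered-map s (punchIn-mono-< a) (punchIn-mono-< a) r)

-- The second letter exceeds the first, so it cannot be the middle of an occurrence that starts at
-- the first letter, and it can replace the first letter as the largest one.
occurrence-ascent : ∀ s (a : Fin (2+ n)) (j : Fin (suc n)) (σ : Permutation′ n) →
                    toℕ a ℕ.≤ toℕ j →
                    Occurrence s ((a ◂ j ◂ σ) ⟨$⟩ʳ_) → Occurrence s ((j ◂ σ) ⟨$⟩ʳ_)
occurrence-ascent s a j σ a≤j (occ {suc _} {suc _} {suc _} (s<s i<j) (s<s j<k) fj<fi fk<fi r) =
  occ i<j j<k (punchIn-cancel-< a fj<fi) (punchIn-cancel-< a fk<fi)
      (ordered-map s (punchIn-cancel-< a) (punchIn-cancel-< a) r)
occurrence-ascent s a j σ a≤j (occ {0F} {1F} _ _ fj<fi _ _) =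
  contradiction a≤j (ℕ.<⇒≱ (Equivalence.to (punchIn<⇔ a j) fj<fi))
occurrence-ascent s a j σ a≤j (occ {0F} {suc (suc x)} {suc (suc y)} i<j (s<s j<k) fj<fi fk<fi r) =
  occ z<s j<k
      (ℕ.<-≤-trans (Equivalence.to (punchIn<⇔ a _) fj<fi) a≤j)
      (ℕ.<-≤-trans (Equivalence.to (punchIn<⇔ a _) fk<fi) a≤j)
      (ordered-map s (punchIn-cancel-< a) (punchIn-cancel-< a) r)

-- Identifies `b ◂ σ` as the standardization of `suc b ◂ j ◂ σ` without its second letter: that
-- letter has value `inject₁ j`, the value skipped on the right.
deleteSecond : ∀ {b j : Fin (suc n)} (σ : Permutation′ n) → j ≤ b → ∀ x →
               (suc b ◂ j ◂ σ) ⟨$⟩ʳ punchIn 1F x ≡ punchIn (inject₁ j) ((b ◂ σ) ⟨$⟩ʳ x)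
deleteSecond {b = b} {j} σ j≤b zero    =
  sym (punchIn-≤ (inject₁ j) b (subst (ℕ._≤ toℕ b) (sym (toℕ-inject₁ j)) j≤b))
deleteSecond             σ j≤b (suc x) = punchIn-comm j≤b (σ ⟨$⟩ʳ x)

module _ {b j : Fin (suc n)} (σ : Permutation′ n) (j≤b : j ≤ b) where

  private
    f = (suc b ◂ j ◂ σ) ⟨$⟩ʳ_
    g = (b ◂ σ) ⟨$⟩ʳ_

    second : f 1F ≡ inject₁ j
    second = punchIn-> (suc b) j (s≤s j≤b)

    second<first : f 1F < f 0F
    second<first = Equivalence.from (punchIn<⇔ (suc b) j) (s≤s j≤b)

    shrink : ∀ x y → f (punchIn 1F x) < f (punchIn 1F y) → g x < g y
    shrink x y = punchIn-cancel-< (inject₁ j)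
               ∘ subst₂ _<_ (deleteSecond σ j≤b x) (deleteSecond σ j≤b y)

    grow : ∀ x y → g x < g y → f (punchIn 1F x) < f (punchIn 1F y)
    grow x y = subst₂ _<_ (sym (deleteSecond σ j≤b x)) (sym (deleteSecond σ j≤b y))
             ∘ punchIn-mono-< (inject₁ j)

  occurrence-insertSecond : ∀ s → Occurrence s g → Occurrence s f
  occurrence-insertSecond s (occ {x} {y} {z} x<y y<z gy<gx gz<gx r) =
    occ (punchIn-mono-< 1F x<y) (punchIn-mono-< 1F y<z) (grow y x gy<gx) (grow z x gz<gx)
        (ordered-map s (grow y z) (grow z y) r)

  -- The second letter cannot be the last of an occurrence, since only one position precedes it. As
  -- the middle one it would need a third letter that `extremal` forbids, and as the first one it is
  -- replaceable.
  occurrence-deleteSecond : ∀ s → (∀ v → v < suc b → ¬ Ordered s (inject₁ j) v) →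
                            Occurrence s f → Occurrence s g
  occurrence-deleteSecond s extremal = go
    where
    go : Occurrence s f → Occurrence s g
    go (occ {0F} {1F} {z} _ _ _ fz<fx r) =
      contradiction (subst (λ v → Ordered s v (f z)) second r) (extremal (f z) fz<fx)
    go (occ {0F} {suc (suc y)} {suc (suc z)} _ (s<s y<z) fy<fx fz<fx r) =
      occ z<s y<z (shrink (suc y) 0F fy<fx) (shrink (suc z) 0F fz<fx)
          (ordered-map s (shrink (suc y) (suc z)) (shrink (suc z) (suc y)) r)
    -- The second letter is smaller than the first one, which can replace it.
    go (occ {1F} {suc (suc y)} {suc (suc z)} _ (s<s y<z) fy<fx fz<fx r) =
      occ z<s y<z (shrink (suc y) 0F (ℕ.<-trans fy<fx second<first))
          (shrink (suc z) 0F (ℕ.<-trans fz<fx second<first))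
          (ordered-map s (shrink (suc y) (suc z)) (shrink (suc z) (suc y)) r)
    go (occ {suc (suc x)} {suc (suc y)} {suc (suc z)} (s<s x<y) (s<s y<z) fy<fx fz<fx r) =
      occ x<y y<z (shrink (suc y) (suc x) fy<fx) (shrink (suc z) (suc x) fz<fx)
          (ordered-map s (shrink (suc y) (suc z)) (shrink (suc z) (suc y)) r)
    go (occ {suc (suc _)} {1F} (s<s ()) _ _ _ _)
    go (occ {1F} {1F} (s<s ()) _ _ _ _)
    go (occ {_} {suc (suc _)} {1F} _ (s<s ()) _ _ _)

  -- Every value occurs somewhere. Since `v` is neither of the two leading letters, it stands after
  -- them and completes an occurrence.
  occurrence-missing : ∀ s v → v < suc b → Ordered s (inject₁ j) v → inject₁ j ≢ v → Occurrence s f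
  occurrence-missing s v v<a r j≢v with (suc b ◂ j ◂ σ) ⟨$⟩ˡ v in eq
  ... | p with trans (cong f (sym eq)) (inverseʳ (suc b ◂ j ◂ σ) {v})
  occurrence-missing s v v<a r j≢v | 0F           | refl = contradiction v<a (ℕ.<-irrefl refl)
  occurrence-missing s v v<a r j≢v | 1F           | fp≡v = contradiction (trans (sym second) fp≡v) j≢v
  occurrence-missing s v v<a r j≢v | suc (suc p)  | refl =
    occ {i = 0F} {1F} {suc (suc p)} z<s (s<s z<s) second<first v<a
        (subst (λ u → Ordered s u (f (suc (suc p)))) (sym second) r)

-- The only value below the current maximum that may come next: the largest
-- available one for 312, the smallest one for 321.
next : Shape → Fin (suc n) → Fin (suc n)
next up   b = b
next down b = 0F

next-≤ : ∀ s (b : Fin (suc n)) → next s b ≤ b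
next-≤ up   b = ℕ.≤-refl
next-≤ down b = z≤n

next-extremal : ∀ s (b : Fin (suc n)) v → v < suc b → ¬ Ordered s (inject₁ (next s b)) v
-- For `down` the forbidden relation would put `v` below `0F`, so that case is empty.
next-extremal up b v v<1+b b<v =
  ℕ.<⇒≱ (subst (ℕ._< toℕ v) (toℕ-inject₁ b) b<v) (ℕ.s≤s⁻¹ v<1+b)

-- The skipped value `next s b` is still to come, and it completes an occurrence with the two
-- leading letters.
occurrence-≢next : ∀ s {b j : Fin (suc n)} (σ : Permutation′ n) → j ≤ b → j ≢ next s b →
                   Occurrence s ((suc b ◂ j ◂ σ) ⟨$⟩ʳ_)
occurrence-≢next up {b} {j} σ j≤b j≢b =
  occurrence-missing σ j≤b up (inject₁ b) (ℕ.≤-reflexive (cong suc (toℕ-inject₁ b))) lt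
    (ℕ.<⇒≢ lt ∘ cong toℕ)
  where
  lt : inject₁ j < inject₁ b
  lt = subst₂ ℕ._<_ (sym (toℕ-inject₁ j)) (sym (toℕ-inject₁ b)) (≤∧≢⇒< j≤b j≢b)
occurrence-≢next down {b} {zero}  σ j≤b j≢0 = contradiction refl j≢0
occurrence-≢next down {b} {suc j} σ j≤b j≢0 =
  occurrence-missing σ j≤b down 0F z<s z<s λ ()

-- Counting with decidable predicates.

private
  variable
    A B X : Set

ind : Dec A → ℕ → ℕ
ind d t = if does d then t else 0

ind-⇔ : (d : Dec A) (e : Dec B) → A ⇔ B → ∀ t → ind d t ≡ ind e t
ind-⇔ d e eq t = cong (λ b → if b then t else 0) (does-⇔ eq d e)

ind-yes : (d : Dec A) → A → ∀ t → ind d t ≡ t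
ind-yes (yes _) _ t = refl
ind-yes (no ¬a) a t = contradiction a ¬a

ind-no : (d : Dec A) → ¬ A → ∀ t → ind d t ≡ 0
ind-no (yes a) ¬a t = contradiction a ¬a
ind-no (no _)  _  t = refl

ind-zero : (d : Dec A) → ind d 0 ≡ 0
ind-zero (yes _) = refl
ind-zero (no _)  = refl

count : {P : X → Set} → Decidable P → List X → ℕ
count P? xs = length (filter P? xs)

count-∷ : {P : X → Set} (P? : Decidable P) → ∀ x xs → count P? (x ∷ xs) ≡ ind (P? x) 1 + count P? xs
count-∷ P? x xs with does (P? x)
... | true  = refl
... | false = refl

count-⇔ : {P Q : X → Set} (P? : Decidable P) (Q? : Decidable Q) → (∀ x → P x ⇔ Q x) →
          ∀ xs → count P? xs ≡ count Q? xs
count-⇔ P? Q? P⇔Q xs =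
  cong length (filter-≐ P? Q? ((λ {x} → Equivalence.to (P⇔Q x)) , (λ {x} → Equivalence.from (P⇔Q x))) xs)

count-none : {P : X → Set} (P? : Decidable P) → (∀ x → ¬ P x) → ∀ xs → count P? xs ≡ 0
count-none P? none xs = cong length (filter-none P? (All.universal none xs))

count-map : ∀ {Y : Set} {P : Y → Set} (P? : Decidable P) (f : X → Y) →
            ∀ xs → count P? (map f xs) ≡ count (P? ∘ f) xs
count-map P? f []       = refl
count-map P? f (x ∷ xs) = begin
  count P? (f x ∷ map f xs)               ≡⟨ count-∷ P? (f x) (map f xs) ⟩
  ind (P? (f x)) 1 + count P? (map f xs)  ≡⟨ cong (ind (P? (f x)) 1 +_) (count-map P? f xs) ⟩
  ind (P? (f x)) 1 + count (P? ∘ f) xs    ≡⟨ count-∷ (P? ∘ f) x xs ⟨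
  count (P? ∘ f) (x ∷ xs)                 ∎
  where open ≡-Reasoning

count-tabulate : ∀ {Y : Set} {P : X → Set} {Q : Y → Set} (P? : Decidable P) (Q? : Decidable Q)
                 (f : Fin n → X) (g : Fin n → Y) → (∀ i → P (f i) ⇔ Q (g i)) →
                 count P? (tabulate f) ≡ count Q? (tabulate g)
count-tabulate {n = zero}  P? Q? f g P⇔Q = refl
count-tabulate {n = suc n} P? Q? f g P⇔Q = begin
  count P? (tabulate f)
    ≡⟨ count-∷ P? (f 0F) (tabulate (f ∘ suc)) ⟩
  ind (P? (f 0F)) 1 + count P? (tabulate (f ∘ suc))
    ≡⟨ cong₂ _+_ (ind-⇔ (P? (f 0F)) (Q? (g 0F)) (P⇔Q 0F) 1)
                 (count-tabulate P? Q? (f ∘ suc) (g ∘ suc) (P⇔Q ∘ suc)) ⟩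
  ind (Q? (g 0F)) 1 + count Q? (tabulate (g ∘ suc))
    ≡⟨ count-∷ Q? (g 0F) (tabulate (g ∘ suc)) ⟨
  count Q? (tabulate g)
    ∎
  where open ≡-Reasoning

-- Used to split a count over `permutations (suc n)` according to the first letter.
count-product : ∀ {Y Z : Set} {P : Z → Set} (P? : Decidable P) (f : X → Y → Z) (g : Fin n → X) ys →
                count P? (cartesianProductWith f (tabulate g) ys) ≡
                sum (λ i → count (P? ∘ f (g i)) ys)
count-product {n = zero}  P? f g ys = refl
count-product {n = suc n} P? f g ys = begin
  count P? (map (f (g 0F)) ys ++ rest)
    ≡⟨ cong length (filter-++ P? (map (f (g 0F)) ys) rest) ⟩
  length (filter P? (map (f (g 0F)) ys) ++ filter P? rest)
    ≡⟨ length-++ (filter P? (map (f (g 0F)) ys)) ⟩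
  count P? (map (f (g 0F)) ys) + count P? rest
    ≡⟨ cong₂ _+_ (count-map P? (f (g 0F)) ys) (count-product P? f (g ∘ suc) ys) ⟩
  sum (λ i → count (P? ∘ f (g i)) ys)
    ∎
  where
  open ≡-Reasoning
  rest = cartesianProductWith f (tabulate (g ∘ suc)) ys

-- Peaks and the leading letters.

pk-◂ : ∀ (a : Fin (3 + n)) (π : Permutation′ (2+ n)) →
       pk (a ◂ π) ≡ ind (peakAt? (a ◂ π) 0F) 1 + pk π
pk-◂ a π = trans (count-∷ (peakAt? (a ◂ π)) 0F (tabulate suc))
  (cong (ind (peakAt? (a ◂ π) 0F) 1 +_)
    (count-tabulate (peakAt? (a ◂ π)) (peakAt? π) suc id λ i →
      mk⇔ (λ (l , r) → punchIn-cancel-< a l , punchIn-cancel-< a r)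
          (λ (l , r) → punchIn-mono-< a l , punchIn-mono-< a r)))

-- The reward `t` is paid if the letter after `a` in `a ◂ π` is smaller than `a`; by `punchIn<⇔` the
-- letter of `π` can be compared before it is shifted. A final letter earns 0.
dip : ℕ → Fin (suc n) → Permutation′ n → ℕ
dip {zero}  t a π = 0
dip {suc n} t a π = ind (toℕ (π ⟨$⟩ʳ 0F) ℕ.<? toℕ a) t

dip-zero : ∀ (a : Fin (suc n)) (π : Permutation′ n) → dip 0 a π ≡ 0
dip-zero {zero}  a π = refl
dip-zero {suc n} a π = ind-zero (toℕ (π ⟨$⟩ʳ 0F) ℕ.<? toℕ a)

-- The first window begins with a rise, so it is a peak exactly when `j` is followed by a smaller
-- letter.
pk-ascent : ∀ (a : Fin (2+ n)) (j : Fin (suc n)) (σ : Permutation′ n) → toℕ a ℕ.≤ toℕ j →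
            pk (a ◂ j ◂ σ) ≡ dip 1 j σ + pk (j ◂ σ)
pk-ascent {zero}  a j σ a≤j = refl
pk-ascent {suc n} a j σ a≤j = trans (pk-◂ a (j ◂ σ)) (cong (_+ pk (j ◂ σ))
  (ind-⇔ (peakAt? (a ◂ j ◂ σ) 0F) (toℕ (σ ⟨$⟩ʳ 0F) ℕ.<? toℕ j)
    (mk⇔ (Equivalence.to (punchIn<⇔ j (σ ⟨$⟩ʳ 0F)) ∘ punchIn-cancel-< a ∘ proj₂)
         (λ lt → subst (a <_) (sym (punchIn-≤ a j a≤j)) (s≤s a≤j) ,
                 punchIn-mono-< a (Equivalence.from (punchIn<⇔ j (σ ⟨$⟩ʳ 0F)) lt)))
    1))

pk-descent : ∀ {a : Fin (2+ n)} {j : Fin (suc n)} (σ : Permutation′ n) → toℕ j ℕ.< toℕ a →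
             pk (a ◂ j ◂ σ) ≡ pk (j ◂ σ)
pk-descent {zero}  σ j<a = refl
pk-descent {suc n} {a} {j} σ j<a = trans (pk-◂ a (j ◂ σ)) (cong (_+ pk (j ◂ σ))
  (ind-no (peakAt? (a ◂ j ◂ σ) 0F)
    (λ (a<j , _) → ℕ.<-asym a<j (Equivalence.from (punchIn<⇔ a j) j<a)) 1))

-- If b > σ₀ > σ₁, then b ◂ σ starts with an occurrence of 321.
pk-next : ∀ s (b : Fin (suc n)) (σ : Permutation′ n) → Avoids (b ◂ σ) (pattern-of s) →
          pk (next s b ◂ σ) ≡ pk (b ◂ σ)
pk-next       up   b σ av = refl
pk-next {0}   down b σ av = refl
pk-next {1}   down b σ av = refl
pk-next {2+ n} down b σ av = begin
  pk (0F ◂ σ)                               ≡⟨ pk-◂ 0F σ ⟩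
  ind (peakAt? (0F ◂ σ) 0F) 1 + pk σ        ≡⟨ cong (_+ pk σ) (ind-⇔ (peakAt? (0F ◂ σ) 0F) (peakAt? (b ◂ σ) 0F) (mk⇔ to from) 1) ⟩
  ind (peakAt? (b ◂ σ) 0F) 1 + pk σ         ≡⟨ pk-◂ b σ ⟨
  pk (b ◂ σ)                                ∎
  where
  open ≡-Reasoning
  to : PeakAt (0F ◂ σ) 0F → PeakAt (b ◂ σ) 0F
  to (_ , s<s r) with <-cmp b (punchIn b (σ ⟨$⟩ʳ 0F))
  ... | tri< lt _ _ = lt , punchIn-mono-< b r
  ... | tri≈ _ eq _ = contradiction (sym eq) (punchInᵢ≢i b (σ ⟨$⟩ʳ 0F))
  ... | tri> _ _ gt = contradiction
    (Equivalence.from (contains⇔occurrence down (b ◂ σ))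
      (occ {i = 0F} {1F} {2F} z<s (s<s z<s) gt (ℕ.<-trans (punchIn-mono-< b r) gt) (punchIn-mono-< b r)))
    av
  from : PeakAt (b ◂ σ) 0F → PeakAt (0F ◂ σ) 0F
  from (_ , r) = z<s , s<s (punchIn-cancel-< b r)

-- The number of peaks of a word c peaks of which have already been read, whose
-- remaining letters are those of a ◂ π, and in which a is a peak worth t if it
-- is followed by a smaller letter.
weight : ℕ → ℕ → Fin (suc n) → Permutation′ n → ℕ
weight c t a π = c + (dip t a π + pk (a ◂ π))

-- No smaller letter follows `a`, so `t` is lost. The new maximum `j` has a smaller letter before
-- it, so it is worth 1 if a descent follows.
weight-ascent : ∀ c t (a : Fin (2+ n)) (j : Fin (suc n)) (σ : Permutation′ n) → toℕ a ℕ.≤ toℕ j →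
                weight c t a (j ◂ σ) ≡ weight c 1 j σ
weight-ascent c t a j σ a≤j =
  cong (c +_) (cong₂ _+_ (ind-no (toℕ j ℕ.<? toℕ a) (ℕ.≤⇒≯ a≤j) t) (pk-ascent a j σ a≤j))

weight-next : ∀ s c t (b : Fin (suc n)) (σ : Permutation′ n) → Avoids (b ◂ σ) (pattern-of s) →
              weight c t (suc b) (next s b ◂ σ) ≡ weight (c + t) 0 b σ
weight-next s c t b σ av = begin
  c + (dip t (suc b) (next s b ◂ σ) + pk (suc b ◂ next s b ◂ σ))
    ≡⟨ cong (c +_) (cong₂ _+_ (ind-yes (toℕ (next s b) ℕ.<? suc (toℕ b)) lt t)
         (trans (pk-descent σ lt) (pk-next s b σ av))) ⟩
  c + (t + pk (b ◂ σ))
    ≡⟨ ℕ.+-assoc c t (pk (b ◂ σ)) ⟨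
  c + t + pk (b ◂ σ)
    ≡⟨ cong (λ d → c + t + (d + pk (b ◂ σ))) (dip-zero b σ) ⟨
  c + t + (dip 0 b σ + pk (b ◂ σ))
    ∎
  where
  open ≡-Reasoning
  lt = s≤s (next-≤ s b)

-- The recursion for the refined counts.

Counted : Shape → (k c t : ℕ) → Fin (suc n) → Permutation′ n → Set
Counted s k c t a π = Avoids (a ◂ π) (pattern-of s) × weight c t a π ≡ k

-- Abstract, since comparing unfolded decision procedures is very slow.
abstract
  counted? : ∀ s k c t (a : Fin (suc n)) → Decidable (Counted s k c t a)
  counted? s k c t a π = avoids? (a ◂ π) (pattern-of s) ×-dec (weight c t a π ℕ.≟ k)

  avoiding? : ∀ k (ρ : Permutation′ 3) → Decidable (λ (π : Permutation′ n) → Avoids π ρ × pk π ≡ k)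
  avoiding? k ρ π = avoids? π ρ ×-dec (pk π ℕ.≟ k)

  aᵖᵏ≡count : ∀ n k ρ → aᵖᵏ n k ρ ≡ count (avoiding? k ρ) (permutations n)
  aᵖᵏ≡count n k ρ = refl

-- The number of ways to finish a word with `n` letters left, `toℕ a` of them below the current
-- maximum, so that it has `k` peaks in all.
continuations : Shape → (k c t : ℕ) → Fin (suc n) → ℕ
continuations {n} s k c t a = count (counted? s k c t a) (permutations n)

continuationsVia : Shape → (k c t : ℕ) → Fin (2+ n) → Fin (suc n) → ℕ
continuationsVia {n} s k c t a j = count (counted? s k c t a ∘ (j ◂_)) (permutations n)

module _ (s : Shape) (k c t : ℕ) where

  continuations-suc : ∀ (a : Fin (2+ n)) → continuations s k c t a ≡ sum (continuationsVia s k c t a)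
  continuations-suc {n} a = count-product (counted? s k c t a) (insert 0F) id (permutations n)

  via-ascent : ∀ (a : Fin (2+ n)) (j : Fin (suc n)) → toℕ a ℕ.≤ toℕ j →
               continuationsVia s k c t a j ≡ continuations s k c 1 j
  via-ascent {n} a j a≤j = count-⇔ (counted? s k c t a ∘ (j ◂_)) (counted? s k c 1 j) (λ σ → mk⇔
    (λ (av , w) → avoids-map s {a ◂ j ◂ σ} {j ◂ σ} (occurrence-tail s a (j ◂ σ)) av ,
                  trans (sym (weight-ascent c t a j σ a≤j)) w)
    (λ (av , w) → avoids-map s {j ◂ σ} {a ◂ j ◂ σ} (occurrence-ascent s a j σ a≤j) av ,
                  trans (weight-ascent c t a j σ a≤j) w))
    (permutations n)

  via-next : ∀ (b : Fin (suc n)) →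
             continuationsVia s k c t (suc b) (next s b) ≡ continuations s k (c + t) 0 b
  via-next {n} b = count-⇔ (counted? s k c t (suc b) ∘ (next s b ◂_)) (counted? s k (c + t) 0 b) (λ σ →
    let to = avoids-map s {suc b ◂ next s b ◂ σ} {b ◂ σ} (occurrence-insertSecond σ (next-≤ s b) s)
        from = avoids-map s {b ◂ σ} {suc b ◂ next s b ◂ σ}
                 (occurrence-deleteSecond σ (next-≤ s b) s (next-extremal s b))
    in mk⇔ (λ (av , w) → to av , trans (sym (weight-next s c t b σ (to av))) w)
           (λ (av , w) → from av , trans (weight-next s c t b σ av) w))
    (permutations n)

  via-≢next : ∀ {b j : Fin (suc n)} → j ≤ b → j ≢ next s b → continuationsVia s k c t (suc b) j ≡ 0
  via-≢next {n} {b} {j} j≤b j≢next =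
    count-none (counted? s k c t (suc b) ∘ (j ◂_))
      (λ σ (av , _) → av (Equivalence.from (contains⇔occurrence s (suc b ◂ j ◂ σ))
                           (occurrence-≢next s σ j≤b j≢next)))
      (permutations n)

-- By induction on `n`. For either shape the count is the sum of `continuations s k c 1 j` over `j`
-- at least `a`, plus `continuations s k (c + t) 0 b` when `a` is `suc b`.
continuations-shape : ∀ k c t (a : Fin (suc n)) → continuations up k c t a ≡ continuations down k c t a
continuations-shape {zero} k c t a =
  count-⇔ (counted? up k c t a) (counted? down k c t a)
    (λ π → mk⇔ (λ (_ , w) → avoids-short down (a ◂ π) (s<s z<s) , w)
               (λ (_ , w) → avoids-short up (a ◂ π) (s<s z<s) , w))
    (permutations 0)
continuations-shape {suc n} k c t a = begin
  continuations up k c t a             ≡⟨ continuations-suc up k c t a ⟩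
  sum (continuationsVia up k c t a)    ≡⟨ sums a ⟩
  sum (continuationsVia down k c t a)  ≡⟨ continuations-suc down k c t a ⟨
  continuations down k c t a           ∎
  where
  open ≡-Reasoning

  ascents : ∀ (a : Fin (2+ n)) (j : Fin (suc n)) → toℕ a ℕ.≤ toℕ j →
            continuationsVia up k c t a j ≡ continuationsVia down k c t a j
  ascents a j a≤j = begin
    continuationsVia up k c t a j    ≡⟨ via-ascent up k c t a j a≤j ⟩
    continuations up k c 1 j         ≡⟨ continuations-shape k c 1 j ⟩
    continuations down k c 1 j       ≡⟨ via-ascent down k c t a j a≤j ⟨
    continuationsVia down k c t a j  ∎

  sums : ∀ (a : Fin (2+ n)) → sum (continuationsVia up k c t a) ≡ sum (continuationsVia down k c t a)
  sums zero    = sum-cong-≗ λ j → ascents zero j z≤n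
  sums (suc b) = begin
    -- The allowed letter below the maximum is split off: it has index `b` for 312 and `0F` for 321.
    sum via-up                                ≡⟨ sum-remove {i = b} via-up ⟩
    via-up b + sum (removeAt via-up b)        ≡⟨ cong₂ _+_ nexts (sum-cong-≗ others) ⟩
    via-down 0F + sum (removeAt via-down 0F)  ≡⟨ sum-remove {i = 0F} via-down ⟨
    sum via-down                              ∎
    where
    via-up via-down : Fin (suc n) → ℕ
    via-up   = continuationsVia up k c t (suc b)
    via-down = continuationsVia down k c t (suc b)

    nexts : via-up b ≡ via-down 0F
    nexts = begin
      via-up b                          ≡⟨ via-next up k c t b ⟩
      continuations up k (c + t) 0 b    ≡⟨ continuations-shape k (c + t) 0 b ⟩
      continuations down k (c + t) 0 b  ≡⟨ via-next down k c t b ⟨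
      via-down 0F                       ∎

    -- For `i` below `b`, both `punchIn b i` and `suc i` are at most `b` and differ from the allowed
    -- letter, so both terms vanish. Otherwise both indices are `suc i`, an ascent.
    others : ∀ i → via-up (punchIn b i) ≡ via-down (suc i)
    others i with toℕ i ℕ.<? toℕ b
    ... | yes i<b = begin
      via-up (punchIn b i)  ≡⟨ via-≢next up k c t (ℕ.<⇒≤ (Equivalence.from (punchIn<⇔ b i) i<b)) (punchInᵢ≢i b i) ⟩
      0                     ≡⟨ via-≢next down k c t i<b (λ ()) ⟨
      via-down (suc i)      ∎
    ... | no  i≮b = begin
      via-up (punchIn b i)  ≡⟨ cong via-up (punchIn-≤ b i (ℕ.≮⇒≥ i≮b)) ⟩
      via-up (suc i)        ≡⟨ ascents (suc b) (suc i) (s≤s (ℕ.≮⇒≥ i≮b)) ⟩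
      via-down (suc i)      ∎

-- Here ρ is related to pattern-of s by a propositional equation because
-- converting aᵖᵏ n k (pattern-of up) to aᵖᵏ n k p312 makes Agda unfold aᵖᵏ.
aᵖᵏ-suc : ∀ s ρ → pattern-of s ≡ ρ → ∀ n k →
          aᵖᵏ (suc n) k ρ ≡ sum (λ (j : Fin (suc n)) → continuations s k 0 0 j)
aᵖᵏ-suc s ρ refl n k = begin
  aᵖᵏ (suc n) k ρ
    ≡⟨ aᵖᵏ≡count (suc n) k ρ ⟩
  count (avoiding? k ρ) (permutations (suc n))
    ≡⟨ count-product (avoiding? k ρ) (insert 0F) id (permutations n) ⟩
  sum (λ (j : Fin (suc n)) → count (avoiding? k ρ ∘ (j ◂_)) (permutations n))
    -- The first letter of a permutation is never a peak, so counting starts with `t` equal to 0.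
    ≡⟨ sum-cong-≗ (λ j → count-⇔ (avoiding? k ρ ∘ (j ◂_)) (counted? s k 0 0 j) (λ π →
         let eq = cong (_+ pk (j ◂ π)) (dip-zero j π) in
         mk⇔ (λ (av , p) → av , trans eq p) (λ (av , p) → av , trans (sym eq) p))
       (permutations n)) ⟩
  sum (λ (j : Fin (suc n)) → continuations s k 0 0 j)
    ∎
  where open ≡-Reasoning

theorem2 : ∀ (n k : ℕ) → aᵖᵏ n k p312 ≡ aᵖᵏ n k p321
theorem2 zero    k = begin
  aᵖᵏ 0 k p312                                ≡⟨ aᵖᵏ≡count 0 k p312 ⟩
  count (avoiding? k p312) (permutations 0)   ≡⟨ count-⇔ (avoiding? k p312) (avoiding? k p321)
                                                   (λ π → mk⇔ (λ (_ , p) → avoids-short down π z<s , p)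
                                                              (λ (_ , p) → avoids-short up π z<s , p))
                                                   (permutations 0) ⟩
  count (avoiding? k p321) (permutations 0)   ≡⟨ aᵖᵏ≡count 0 k p321 ⟨
  aᵖᵏ 0 k p321                                ∎
  where open ≡-Reasoning
theorem2 (suc n) k = begin
  aᵖᵏ (suc n) k p312                                      ≡⟨ aᵖᵏ-suc up p312 refl n k ⟩
  sum (λ (j : Fin (suc n)) → continuations up k 0 0 j)    ≡⟨ sum-cong-≗ (continuations-shape {n} k 0 0) ⟩
  sum (λ (j : Fin (suc n)) → continuations down k 0 0 j)  ≡⟨ aᵖᵏ-suc down p321 refl n k ⟨
  aᵖᵏ (suc n) k p321                                      ∎
  where open ≡-Reasoning
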